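{- Let $n\ge 5$, let $M$ be a matching of the complete graph $K_n$, and let $G=K_n\setminus M$ be the graph obtained from $K_n$ by deleting the edges of $M$. If $M$ is a perfect matching, then $\gamma_3(G)=4$; otherwise $\gamma_3(G)=3$.
   Context: In a graph $G=(V,E)$, a vertex dominates itself and its neighbours. A set $S\subseteq V$ is a three dominating set of $G$ if every vertex in $V\setminus S$ is dominated by at least three vertices of $S$ (equivalently, every vertex of $V\setminus S$ has at least three neighbours in $S$). The three domination number $\gamma_3(G)$ is the minimum cardinality of a three dominating set of $G$. -}

module Defs where

open import Data.Fin using (Fin)
open import Data.Fin.Properties using (_≟_)
open import Data.Fin.Subset using (Subset; _∉_; _∩_; ∣_∣)
open import Data.Nat using (ℕ; _≤_)
open import Data.Product using (∃-syntax; _×_; _,_; map)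
open import Data.Sum using (_⊎_)
open import Data.Vec using (tabulate)
open import Relation.Binary.Definitions using (Decidable; Symmetric; Irreflexive)
open import Relation.Binary.PropositionalEquality using (_≡_; _≢_; ≢-sym)
open import Relation.Nullary using (¬_; does)
open import Relation.Nullary.Decidable using (¬?; _×-dec_; _⊎-dec_)

-- Finite simple graphs on the vertex set Fin n.  Adjacency is decidable,
-- as it is classically for every finite graph.
record Graph (n : ℕ) : Set₁ where
  field
    Adj    : Fin n → Fin n → Set
    adj?   : Decidable Adj
    sym    : Symmetric Adj
    irrefl : Irreflexive _≡_ Adj

open Graph public using (Adj; adj?)

-- A set of edges of G: Edge u v says that the unordered pair {u , v} belongs
-- to the set.
record EdgeSet {n : ℕ} (G : Graph n) : Set₁ where
  field
    Edge  : Fin n → Fin n → Set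
    edge? : Decidable Edge
    sym   : Symmetric Edge
    ⊆Adj  : ∀ {u v} → Edge u v → Adj G u v

open EdgeSet public using (Edge; edge?)

K : (n : ℕ) → Graph n
K n = record
  { Adj    = _≢_
  ; adj?   = λ u v → ¬? (u ≟ v)
  ; sym    = ≢-sym
  ; irrefl = λ u≡v u≢v → u≢v u≡v
  }

infixl 6 _∖_

_∖_ : {n : ℕ} (G : Graph n) → EdgeSet G → Graph n
G ∖ M = record
  { Adj    = λ u v → Adj G u v × ¬ Edge M u v
  ; adj?   = λ u v → adj? G u v ×-dec ¬? (edge? M u v)
  ; sym    = map (Graph.sym G) (λ uv∉M vu∈M → uv∉M (EdgeSet.sym M vu∈M))
  ; irrefl = λ { u≡v (uv , _) → Graph.irrefl G u≡v uv }
  }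

-- Two edges of M that share an endpoint u coincide.
IsMatching : {n : ℕ} {G : Graph n} → EdgeSet G → Set
IsMatching M = ∀ {u v w} → Edge M u v → Edge M u w → v ≡ w

IsPerfectMatching : {n : ℕ} {G : Graph n} → EdgeSet G → Set
IsPerfectMatching M = IsMatching M × (∀ v → ∃[ w ] Edge M v w)

Dominates : {n : ℕ} → Graph n → Fin n → Fin n → Set
Dominates G u v = u ≡ v ⊎ Adj G u v

dominates? : {n : ℕ} (G : Graph n) → Decidable (Dominates G)
dominates? G u v = (u ≟ v) ⊎-dec adj? G u v

dominators : {n : ℕ} → Graph n → Fin n → Subset n
dominators G v = tabulate (λ u → does (dominates? G u v))

IsThreeDominating : {n : ℕ} → Graph n → Subset n → Set
IsThreeDominating G S = ∀ v → v ∉ S → 3 ≤ ∣ dominators G v ∩ S ∣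

-- "γ₃(G) = k": k is the minimum of the cardinalities of the three dominating
-- sets of G.
record IsThreeDominationNumber {n : ℕ} (G : Graph n) (k : ℕ) : Set where
  field
    attained : ∃[ S ] (IsThreeDominating G S × ∣ S ∣ ≡ k)
    minimal  : ∀ S → IsThreeDominating G S → k ≤ ∣ S ∣

{-# OPTIONS --safe #-}
-- Outside S, a vertex misses at most one element of S, namely its mate.  So any
-- four vertices are three dominating, whereas three vertices are three
-- dominating exactly when they are closed under taking mates.  If M is perfect
-- then a closed set splits into pairs and cannot have three elements.
module Submission where

open import Defs
open import Data.Fin using (Fin; zero; suc)
open import Data.Fin.Properties using (_≟_; any?; ¬∀⟶∃¬)
open import Data.Fin.Subset using (Subset; Nonempty; inside; outside; _∈_; _∉_; _⊆_; _∩_; _∪_; _-_; ⁅_⁆; ⊥; ∁; ∣_∣)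
open import Data.Fin.Subset.Properties
open import Data.Nat using (ℕ; zero; suc; _+_; _≤_; _<_; z≤n; s≤s; s≤s⁻¹; _≤?_)
open import Data.Nat.Properties using (≤-trans; ≤-refl; ≤-reflexive; ≤-antisym; <-≤-trans; ≤-<-trans; n≮n; ≰⇒>; ≮⇒≥; m<n⇒0<n∸m; n≤1+n; module ≤-Reasoning)
open import Data.Product using (∃-syntax; _×_; _,_; proj₂)
open import Data.Sum using (inj₁; inj₂)
open import Data.Vec using (_∷_; here; there)
open import Data.Vec.Properties using (lookup⇒[]=; []=⇒lookup; lookup∘tabulate)
open import Relation.Binary.PropositionalEquality using (_≡_; _≢_; refl; sym; trans; cong; subst; ≢-sym)
open import Relation.Nullary using (¬_; yes; no; proof; Reflects; contradiction)
open import Relation.Nullary.Decidable using (dec-true)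
open import Relation.Nullary.Reflects using (invert)

private variable
  n : ℕ
  x y : Fin n

∣⁅x⁆∪p∣≤1+∣p∣ : (x : Fin n) (p : Subset n) → ∣ ⁅ x ⁆ ∪ p ∣ ≤ suc ∣ p ∣
∣⁅x⁆∪p∣≤1+∣p∣ zero (inside ∷ p)
  rewrite ∪-identityˡ p = n≤1+n _
∣⁅x⁆∪p∣≤1+∣p∣ zero (outside ∷ p)
  rewrite ∪-identityˡ p = ≤-refl
∣⁅x⁆∪p∣≤1+∣p∣ (suc x) (inside ∷ p) = s≤s (∣⁅x⁆∪p∣≤1+∣p∣ x p)
∣⁅x⁆∪p∣≤1+∣p∣ (suc x) (outside ∷ p) = ∣⁅x⁆∪p∣≤1+∣p∣ x p

x∉p⇒∣⁅x⁆∪p∣≡1+∣p∣ : (p : Subset n) → x ∉ p → ∣ ⁅ x ⁆ ∪ p ∣ ≡ suc ∣ p ∣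
x∉p⇒∣⁅x⁆∪p∣≡1+∣p∣ {x = x} p x∉p = ≤-antisym (∣⁅x⁆∪p∣≤1+∣p∣ x p)
  (p⊂q⇒∣p∣<∣q∣ (q⊆p∪q ⁅ x ⁆ p , x , p⊆p∪q p (x∈⁅x⁆ x) , x∉p))

-- Removing `x` a second time changes nothing, whereas removing a member strictly lowers the
-- cardinality.
x∉p-x : (p : Subset n) (x : Fin n) → x ∉ p - x
x∉p-x p x x∈p-x = n≮n ∣ p - x ∣
  (subst (λ q → ∣ q ∣ < ∣ p - x ∣) (p─q─q≡p─q p ⁅ x ⁆) (x∈p⇒∣p-x∣<∣p∣ x∈p-x))

-- `x` may lie outside `p`: in either case `⁅ x ⁆` and `p - x` together cover `p`.
∣p∣≤1+∣p-x∣ : (p : Subset n) (x : Fin n) → ∣ p ∣ ≤ suc ∣ p - x ∣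
∣p∣≤1+∣p-x∣ p x = ≤-trans (p⊆q⇒∣p∣≤∣q∣ p⊆) (∣⁅x⁆∪p∣≤1+∣p∣ x (p - x))
  where
  p⊆ : p ⊆ ⁅ x ⁆ ∪ (p - x)
  p⊆ {y} y∈p with y ≟ x
  ... | yes refl = x∈p∪q⁺ (inj₁ (x∈⁅x⁆ x))
  ... | no y≢x = x∈p∪q⁺ {p = ⁅ x ⁆} (inj₂ (x∈p∧x≢y⇒x∈p-y y∈p y≢x))

∣p∣>0⇒Nonempty : (p : Subset n) → 0 < ∣ p ∣ → Nonempty p
∣p∣>0⇒Nonempty (inside ∷ p) _ = zero , here
∣p∣>0⇒Nonempty (outside ∷ p) 0<∣p∣ with ∣p∣>0⇒Nonempty p 0<∣p∣
... | x , x∈p = suc x , there x∈p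

∣p∣<n⇒∃∉ : (p : Subset n) → ∣ p ∣ < n → ∃[ x ] x ∉ p
∣p∣<n⇒∃∉ p ∣p∣<n
  with ∣p∣>0⇒Nonempty (∁ p) (subst (0 <_) (sym (∣∁p∣≡n∸∣p∣ p)) (m<n⇒0<n∸m ∣p∣<n))
... | x , x∈∁p = x , x∈∁p⇒x∉p x∈∁p

∃-subset-of-size : ∀ {k} → k ≤ n → ∃[ p ] ∣_∣ {n} p ≡ k
∃-subset-of-size {n} {zero} _ = ⊥ , ∣⊥∣≡0 n
∃-subset-of-size {suc n} {suc k} (s≤s k≤n) with ∃-subset-of-size k≤n
... | p , ∣p∣≡k = inside ∷ p , cong suc ∣p∣≡k

∈-dominators⁺ : (G : Graph n) → Dominates G x y → x ∈ dominators G y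
∈-dominators⁺ {x = x} {y} G d = lookup⇒[]= x _
  (trans (lookup∘tabulate _ x) (dec-true (dominates? G x y) d))

∈-dominators⁻ : (G : Graph n) → x ∈ dominators G y → Dominates G x y
-- Membership fixes the boolean of `dominates? G x y` to `inside`, that is `true`; transporting the
-- `Reflects` proof of this decision along that equation yields the proposition.
∈-dominators⁻ {x = x} {y} G x∈ = invert (subst (Reflects _)
  (trans (sym (lookup∘tabulate _ x)) ([]=⇒lookup x∈)) (proof (dominates? G x y)))

-- At most two vertices leave some vertex outside, and they cannot dominate it three times.
3≤∣threeDominating∣ : (G : Graph n) → 3 ≤ n → ∀ S → IsThreeDominating G S → 3 ≤ ∣ S ∣
3≤∣threeDominating∣ G 3≤n S dom = ≮⇒≥ λ ∣S∣<3 →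
  let v , v∉S = ∣p∣<n⇒∃∉ S (<-≤-trans ∣S∣<3 3≤n)
  in n≮n 3 (≤-<-trans (≤-trans (dom v v∉S) (∣p∩q∣≤∣q∣ (dominators G v) S)) ∣S∣<3)

completelyJoined⇒threeDominating : (G : Graph n) → ∀ S → 3 ≤ ∣ S ∣ →
  (∀ {u v} → u ∈ S → v ∉ S → Adj G u v) → IsThreeDominating G S
completelyJoined⇒threeDominating G S 3≤∣S∣ joined v v∉S = ≤-trans 3≤∣S∣
  (p⊆q⇒∣p∣≤∣q∣ λ u∈S → x∈p∩q⁺ (∈-dominators⁺ G (inj₂ (joined u∈S v∉S)) , u∈S))

∈∧∉⇒≢ : {S : Subset n} → x ∈ S → y ∉ S → x ≢ y
∈∧∉⇒≢ x∈S y∉S refl = y∉S x∈S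

module _ (M : EdgeSet (K n)) (matching : IsMatching M) where

  private
    G = K n ∖ M

  Edge-sym : Edge M x y → Edge M y x
  Edge-sym = EdgeSet.sym M

  matched-unique : ∀ {u v w} → Edge M u w → Edge M v w → u ≡ v
  matched-unique uw vw = matching (Edge-sym uw) (Edge-sym vw)

  -- No deleted edge joins `S` to its complement, so each outside vertex keeps all of `S` as
  -- neighbours.
  closed⇒threeDominating : ∀ S → 3 ≤ ∣ S ∣ →
    (∀ {u v} → u ∈ S → Edge M u v → v ∈ S) → IsThreeDominating G S
  closed⇒threeDominating S 3≤∣S∣ closed = completelyJoined⇒threeDominating G S 3≤∣S∣
    λ u∈S v∉S → ∈∧∉⇒≢ u∈S v∉S , λ uv → v∉S (closed u∈S uv)

  module _ (mate : ∀ v → ∃[ w ] Edge M v w) where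

    4≤∣S∣⇒threeDominating : ∀ S → 4 ≤ ∣ S ∣ → IsThreeDominating G S
    4≤∣S∣⇒threeDominating S 4≤∣S∣ v v∉S with mate v
    -- Whether or not the mate `m` of `v` lies in `S`, discarding it leaves at least three elements,
    -- all of them adjacent to `v`.
    ... | m , vm = s≤s⁻¹ (≤-trans 4≤∣S∣ (≤-trans (∣p∣≤1+∣p-x∣ S m)
      (s≤s (p⊆q⇒∣p∣≤∣q∣ S-m⊆))))
      where
      S-m⊆ : S - m ⊆ dominators G v ∩ S
      S-m⊆ {u} u∈S-m = x∈p∩q⁺ (∈-dominators⁺ G (inj₂ (∈∧∉⇒≢ u∈S v∉S , ¬uv)) , u∈S)
        where
        u∈S = p─q⊆p S ⁅ m ⁆ u∈S-m
        ¬uv : ¬ Edge M u v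
        ¬uv uv with matched-unique uv (Edge-sym vm)
        ... | refl = x∉p-x S m u∈S-m

    -- A three dominating set of size 3 is joined completely to its complement,
    -- so it contains the mates of its elements.
    threeDominating∧∣S∣≤3⇒closed : ∀ S → IsThreeDominating G S → ∣ S ∣ ≤ 3 →
      ∀ {u v} → u ∈ S → Edge M u v → v ∈ S
    threeDominating∧∣S∣≤3⇒closed S dom ∣S∣≤3 {u} {v} u∈S uv with v ∈? S
    ... | yes v∈S = v∈S
    ... | no v∉S = contradiction
      (≤-<-trans (≤-trans (dom v v∉S) (p⊆q⇒∣p∣≤∣q∣ dominators⊆))
        (<-≤-trans (x∈p⇒∣p-x∣<∣p∣ u∈S) ∣S∣≤3))
      (n≮n 3)
      where
      dominators⊆ : dominators G v ∩ S ⊆ S - u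
      dominators⊆ {w} w∈ with x∈p∩q⁻ (dominators G v) S w∈
      ... | w∈D , w∈S = x∈p∧x≢y⇒x∈p-y w∈S w≢u
        where
        w≢u : w ≢ u
        w≢u refl with ∈-dominators⁻ G w∈D
        ... | inj₁ refl = v∉S w∈S
        ... | inj₂ (_ , ¬wv) = ¬wv uv

    -- Two of the pairs suffice: an element `a` with its mate `b`, then a third element `c` with its
    -- mate `d`.
    3≤∣closed∣⇒4≤∣closed∣ : ∀ S → 3 ≤ ∣ S ∣ →
      (∀ {u v} → u ∈ S → Edge M u v → v ∈ S) → 4 ≤ ∣ S ∣
    3≤∣closed∣⇒4≤∣closed∣ S 3≤∣S∣ closed
      with ∣p∣>0⇒Nonempty S (≤-trans (s≤s z≤n) 3≤∣S∣)
    ... | a , a∈S with mate a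
    ... | b , ab with ∣p∣>0⇒Nonempty (S - a - b)
      (s≤s⁻¹ (s≤s⁻¹ (≤-trans 3≤∣S∣ (≤-trans (∣p∣≤1+∣p-x∣ S a) (s≤s (∣p∣≤1+∣p-x∣ (S - a) b))))))
    ... | c , c∈S-a-b with mate c
    ... | d , cd = begin
      -- Read from the bottom up, each removal of `a`, `b`, `c` costs one element, and `d` survives
      -- all three.
      4                            ≤⟨ s≤s (s≤s (s≤s (≤-trans (s≤s z≤n) (x∈p⇒∣p-x∣<∣p∣ d∈S-a-b-c)))) ⟩
      3 + ∣ S - a - b - c ∣        ≤⟨ s≤s (s≤s (x∈p⇒∣p-x∣<∣p∣ c∈S-a-b)) ⟩
      2 + ∣ S - a - b ∣            ≤⟨ s≤s (x∈p⇒∣p-x∣<∣p∣ b∈S-a) ⟩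
      1 + ∣ S - a ∣                ≤⟨ x∈p⇒∣p-x∣<∣p∣ a∈S ⟩
      ∣ S ∣                        ∎
      where
      open ≤-Reasoning
      c∈S-a = p─q⊆p (S - a) ⁅ b ⁆ c∈S-a-b
      c∈S = p─q⊆p S ⁅ a ⁆ c∈S-a
      b∈S-a = x∈p∧x≢y⇒x∈p-y (closed a∈S ab) (≢-sym (EdgeSet.⊆Adj M ab))
      -- If `d` were `a` or `b`, then uniqueness of mates would make `c` equal to `b` or `a`
      -- respectively, both of which have been removed.
      d≢a : d ≢ a
      d≢a refl with matching ab (Edge-sym cd)
      ... | refl = x∉p-x (S - a) b c∈S-a-b
      d≢b : d ≢ b
      d≢b refl with matched-unique ab cd
      ... | refl = x∉p-x S a c∈S-a
      d∈S-a-b-c = x∈p∧x≢y⇒x∈p-y (x∈p∧x≢y⇒x∈p-y (x∈p∧x≢y⇒x∈p-y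
        (closed c∈S cd) d≢a) d≢b) (≢-sym (EdgeSet.⊆Adj M cd))

    perfect⇒4 : 4 ≤ n → IsThreeDominationNumber G 4
    perfect⇒4 4≤n = record { attained = attained ; minimal = minimal }
      where
      attained : ∃[ S ] (IsThreeDominating G S × ∣ S ∣ ≡ 4)
      attained with ∃-subset-of-size 4≤n
      ... | S , ∣S∣≡4 = S , 4≤∣S∣⇒threeDominating S (≤-reflexive (sym ∣S∣≡4)) , ∣S∣≡4

      minimal : ∀ S → IsThreeDominating G S → 4 ≤ ∣ S ∣
      minimal S dom with 4 ≤? ∣ S ∣
      ... | yes 4≤∣S∣ = 4≤∣S∣
      -- Here `S` has at most three elements, hence is closed under mates, and the two pairs then
      -- give the bound itself.
      ... | no 4≰∣S∣ = 3≤∣closed∣⇒4≤∣closed∣ S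
        (3≤∣threeDominating∣ G (≤-trans (n≤1+n 3) 4≤n) S dom)
        (threeDominating∧∣S∣≤3⇒closed S dom (s≤s⁻¹ (≰⇒> 4≰∣S∣)))

  -- Since `M` is a matching, perfection can fail only at a vertex without a mate; deciding `Edge`
  -- over the finite vertex set finds one.
  unmatched : ¬ IsPerfectMatching M → ∃[ v ] ¬ (∃[ w ] Edge M v w)
  unmatched ¬perfect = ¬∀⟶∃¬ n _ (λ v → any? (edge? M v)) λ mate → ¬perfect (matching , mate)

  -- An unmatched vertex together with an edge of M is closed under taking
  -- mates; if M has no edge, then every set is.
  closed-triple : 3 ≤ n → ¬ IsPerfectMatching M →
    ∃[ S ] (∣ S ∣ ≡ 3 × (∀ {u v} → u ∈ S → Edge M u v → v ∈ S))
  closed-triple 3≤n ¬perfect with any? (λ a → any? (edge? M a))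
  ... | no ∄edge with ∃-subset-of-size 3≤n
  ...   | S , ∣S∣≡3 = S , ∣S∣≡3 , λ _ uv → contradiction (_ , _ , uv) ∄edge
  closed-triple 3≤n ¬perfect | yes (a , b , ab) with unmatched ¬perfect
  ... | z , z-unmatched = S , ∣S∣≡3 , closed
    where
    S = ⁅ z ⁆ ∪ (⁅ a ⁆ ∪ ⁅ b ⁆)

    z∉ab : z ∉ ⁅ a ⁆ ∪ ⁅ b ⁆
    z∉ab z∈ with x∈p∪q⁻ ⁅ a ⁆ ⁅ b ⁆ z∈
    ... | inj₁ z∈a with refl ← x∈⁅y⁆⇒x≡y a z∈a = z-unmatched (b , ab)
    ... | inj₂ z∈b with refl ← x∈⁅y⁆⇒x≡y b z∈b = z-unmatched (a , Edge-sym ab)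

    ∣S∣≡3 : ∣ S ∣ ≡ 3
    ∣S∣≡3 = trans (x∉p⇒∣⁅x⁆∪p∣≡1+∣p∣ _ z∉ab) (cong suc
      (trans (x∉p⇒∣⁅x⁆∪p∣≡1+∣p∣ _ (x≢y⇒x∉⁅y⁆ (EdgeSet.⊆Adj M ab))) (cong suc (∣⁅x⁆∣≡1 b))))

    a∈S : a ∈ S
    a∈S = q⊆p∪q ⁅ z ⁆ _ (p⊆p∪q ⁅ b ⁆ (x∈⁅x⁆ a))

    b∈S : b ∈ S
    b∈S = q⊆p∪q ⁅ z ⁆ _ (q⊆p∪q ⁅ a ⁆ ⁅ b ⁆ (x∈⁅x⁆ b))

    closed : ∀ {u v} → u ∈ S → Edge M u v → v ∈ S
    closed u∈S uv with x∈p∪q⁻ ⁅ z ⁆ _ u∈S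
    ... | inj₁ u∈z with refl ← x∈⁅y⁆⇒x≡y z u∈z = contradiction (_ , uv) z-unmatched
    ... | inj₂ u∈ab with x∈p∪q⁻ ⁅ a ⁆ ⁅ b ⁆ u∈ab
    -- By uniqueness, the mate of `a` is `b`, and conversely.
    ...   | inj₁ u∈a with refl ← x∈⁅y⁆⇒x≡y a u∈a = subst (_∈ S) (matching ab uv) b∈S
    ...   | inj₂ u∈b with refl ← x∈⁅y⁆⇒x≡y b u∈b = subst (_∈ S) (matching (Edge-sym ab) uv) a∈S

  ¬perfect⇒3 : 3 ≤ n → ¬ IsPerfectMatching M → IsThreeDominationNumber G 3
  ¬perfect⇒3 3≤n ¬perfect = record
    { attained = let S , ∣S∣≡3 , closed = closed-triple 3≤n ¬perfect in
        S , closed⇒threeDominating S (≤-reflexive (sym ∣S∣≡3)) closed , ∣S∣≡3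
    ; minimal = 3≤∣threeDominating∣ G 3≤n
    }

theorem2p7 : (n : ℕ) → 5 ≤ n → (M : EdgeSet (K n)) → IsMatching M →
    (IsPerfectMatching M → IsThreeDominationNumber (K n ∖ M) 4) ×
    (¬ IsPerfectMatching M → IsThreeDominationNumber (K n ∖ M) 3)
theorem2p7 n 5≤n M matching =
  (λ perfect → perfect⇒4 M matching (proj₂ perfect) (≤-trans (n≤1+n 4) 5≤n)) ,
  ¬perfect⇒3 M matching (≤-trans (s≤s (s≤s (s≤s z≤n))) 5≤n)
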